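{- For every set of operators $\mathcal O \subseteq \{\Box^*, \Box_P, \Box_F\}$, the parameterised problem $\mathrm{Detect}^{\mathcal O}(\mathrm{HORN})$ is fixed-parameter tractable. That is, there are a computable function $f\colon\mathbb N\to\mathbb N$ and a deterministic algorithm that, given an $\mathrm{LTL}^{\mathcal O}_{\mathrm{CNF}}$ formula $\phi$ and an integer $k\in\mathbb N$, finds a strong $\mathrm{HORN}$-backdoor of $\phi$ of size at most $k$ if one exists (and reports that none exists otherwise), in time $f(k)\cdot |x|^{O(1)}$, where $|x|$ is the size of the input.
   Context: **Formulas.** Let $\mathcal O\subseteq\{\Box_F,\Box_P,\Box^*\}$ be a set of temporal operators ("always in the future", "always in the past", "always"). A temporal literal over $\mathcal O$ is $\bot$, a propositional variable $p$, or $Op$ with $O\in\mathcal O$ and $p$ a propositional variable (operators are not nested). A clause is a disjunction $\lnot\lambda_1\lor\dots\lor\lnot\lambda_n\lor\lambda_{n+1}\lor\dots\lor\lambda_{n+m}$ of negated and positive temporal literals. An $\mathrm{LTL}^{\mathcal O}_{\mathrm{CNF}}$ formula is a formula $\phi=\Psi\land\Box^*\Phi$, where $\Phi$ is a conjunction of clauses over $\mathcal O$ and $\Psi$ is a conjunction of propositional variables from $\Phi$ (the outermost $\Box^*$ is always allowed, regardless of $\mathcal O$). It belongs to $\mathrm{HORN}$ if every clause of $\Phi$ has at most one positive temporal literal ($m\le 1$). $\mathrm{Vars}(\phi)$ is the set of propositional variables of $\phi$. **Backdoors.** Let $X\subseteq \mathrm{Vars}(\phi)$. An assignment $\theta\colon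 X\cup\{Ox\mid x\in X, O\in\mathcal O\}\to\{0,1\}$ is consistent if for every $x\in X$: if $\theta(\Box^* x)=1$ then also $\theta(\Box_P x)=1$, $\theta(\Box_F x)=1$ and $\theta(x)=1$ (the condition concerns only those literals lying in the domain of $\theta$). The reduct $\phi[\theta]$ is obtained from $\phi$ by deleting all clauses containing a literal satisfied by $\theta$ and deleting all literals falsified by $\theta$ from the remaining clauses; empty clauses are replaced by false and the empty formula by true. For a class $\mathcal C$ of formulas, $X$ is a strong $\mathcal C$-backdoor of $\phi$ (with respect to $\mathcal O$) if $\phi[\theta]\in\mathcal C$ for every consistent assignment $\theta\colon X\cup\{Ox\mid x\in X,O\in\mathcal O\}\to\{0,1\}$. **Problem $\mathrm{Detect}^{\mathcal O}(\mathcal C)$.** Input: an $\mathrm{LTL}^{\mathcal O}_{\mathrm{CNF}}$ formula $\phi$ and an integer $k\in\mathbb N$. Parameter: $k$. Task: find a strong $\mathcal C$-backdoor of $\phi$ of size $\le k$ if one exists.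
   Formalization: The formal theorem assumes that no clause of Φ is tautological, i.e. satisfied by every consistent assignment to all variables; with such clauses (e.g. disjunctions of ¬x ∨ x) the problem encodes Hitting Set and is W[2]-hard, so the claim would fail unless FPT = W[2]. -}

module Defs where

open import Data.Bool using (Bool; true; false; T; not; _∨_)
import Data.Bool.Properties as Bool
open import Data.Fin using (Fin; zero)
open import Data.List using (List; []; _∷_; [_]; _++_; any; concatMap; filterᵇ; length; map)
import Data.List.Properties as List
open import Data.List.Membership.Propositional using (_∈_)
import Data.List.Membership.DecPropositional as DecMembership
open import Data.List.Relation.Unary.All using (All)
open import Data.List.Relation.Binary.Subset.Propositional using (_⊆_)
open import Data.List.Relation.Unary.Unique.Propositional using (Unique)
open import Data.Maybe using (Maybe; just; nothing)
open import Data.Nat using (ℕ; suc; _+_; _*_; _^_; _≤_)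
open import Data.Nat.Binary using (ℕᵇ; 2[1+_]; 1+[2_]; fromℕ) renaming (zero to 0ᵇ)
open import Data.Product using (Σ-syntax; ∃-syntax; _×_)
open import Data.Vec using (Vec; _∷_; head; lookup; replicate; _[_]≔_)
open import Relation.Binary.Definitions using (DecidableEquality)
open import Relation.Binary.PropositionalEquality using (_≡_; _≢_)
open import Relation.Nullary using (¬_; yes; no)

------------------------------------------------------------------------
-- Formulas

data Op : Set where
  □F □P □* : Op

OpSet : Set
OpSet = Op → Bool

-- Variables are named by words over {0,1}, so that the length of a name
-- counts towards the size of an input.
Var : Set
Var = List Bool

_≟ᵛ_ : DecidableEquality Var
_≟ᵛ_ = List.≡-dec Bool._≟_

open DecMembership _≟ᵛ_ using (_∈?_)

data Atom (𝒪 : OpSet) : Set where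
  var : Var → Atom 𝒪
  box : (o : Op) → T (𝒪 o) → Var → Atom 𝒪

data Literal (𝒪 : OpSet) : Set where
  ⊥ℓ : Literal 𝒪
  at : Atom 𝒪 → Literal 𝒪

-- ¬λ₁ ∨ … ∨ ¬λₙ ∨ λₙ₊₁ ∨ … ∨ λₙ₊ₘ with neg = λ₁ … λₙ and
-- pos = λₙ₊₁ … λₙ₊ₘ; the empty clause is false.
record Clause (𝒪 : OpSet) : Set where
  constructor clause
  field
    neg pos : List (Literal 𝒪)

open Clause public

-- Ψ ∧ □* Φ, where an empty conjunction is true.  Ψ is allowed to consist
-- of arbitrary clauses because a reduct may turn a conjunct of Ψ into
-- false; the shape of Ψ in an LTL-CNF formula is prescribed by IsLTLCNF.
record CNF (𝒪 : OpSet) : Set where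
  constructor _∧□*_
  field
    Ψ Φ : List (Clause 𝒪)

open CNF public

module _ {𝒪 : OpSet} where

  name : Atom 𝒪 → Var
  name (var x)     = x
  name (box _ _ x) = x

  litVars : Literal 𝒪 → List Var
  litVars ⊥ℓ     = []
  litVars (at a) = [ name a ]

  clauseVars : Clause 𝒪 → List Var
  clauseVars c = concatMap litVars (neg c ++ pos c)

  vars : CNF 𝒪 → List Var
  vars φ = concatMap clauseVars (Ψ φ ++ Φ φ)

  IsLTLCNF : CNF 𝒪 → Set
  IsLTLCNF φ =
    All (λ c → ∃[ p ] c ≡ clause [] [ at (var p) ] × p ∈ concatMap clauseVars (Φ φ)) (Ψ φ)

  HORN : CNF 𝒪 → Set
  HORN φ = All (λ c → length (pos c) ≤ 1) (Φ φ)

------------------------------------------------------------------------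
-- Backdoors

-- A map X ∪ {O x ∣ x ∈ X, O ∈ 𝒪} → {0,1}.
Assignment : OpSet → List Var → Set
Assignment 𝒪 X = (a : Atom 𝒪) → name a ∈ X → Bool

module _ {𝒪 : OpSet} {X : List Var} where

  Consistent : Assignment 𝒪 X → Set
  Consistent θ = ∀ x (x∈X : x ∈ X) (h* : T (𝒪 □*)) → θ (box □* h* x) x∈X ≡ true →
    ((hP : T (𝒪 □P)) → θ (box □P hP x) x∈X ≡ true) ×
    ((hF : T (𝒪 □F)) → θ (box □F hF x) x∈X ≡ true) ×
    θ (var x) x∈X ≡ true

  -- ⊥ is not in the domain of an assignment.
  value : Assignment 𝒪 X → Literal 𝒪 → Maybe Bool
  value θ ⊥ℓ = nothing
  value θ (at a) with name a ∈? X
  ... | yes x∈X = just (θ a x∈X)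
  ... | no  _   = nothing

  isTrue isFalse : Assignment 𝒪 X → Literal 𝒪 → Bool
  isTrue θ l with value θ l
  ... | just b  = b
  ... | nothing = false
  isFalse θ l with value θ l
  ... | just b  = not b
  ... | nothing = false

  satisfies : Assignment 𝒪 X → Clause 𝒪 → Bool
  satisfies θ c = any (isFalse θ) (neg c) ∨ any (isTrue θ) (pos c)

  shrink : Assignment 𝒪 X → Clause 𝒪 → Clause 𝒪
  shrink θ c = clause (filterᵇ (λ l → not (isTrue  θ l)) (neg c))
                      (filterᵇ (λ l → not (isFalse θ l)) (pos c))

  reduceClauses : Assignment 𝒪 X → List (Clause 𝒪) → List (Clause 𝒪)
  reduceClauses θ cs = map (shrink θ) (filterᵇ (λ c → not (satisfies θ c)) cs)

_[_]ʳ : ∀ {𝒪 X} → CNF 𝒪 → Assignment 𝒪 X → CNF 𝒪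
φ [ θ ]ʳ = reduceClauses θ (Ψ φ) ∧□* reduceClauses θ (Φ φ)

-- The finite set X is given as a list without repetitions.
record StrongBackdoor {𝒪 : OpSet} (𝒞 : CNF 𝒪 → Set) (φ : CNF 𝒪) (X : List Var) : Set where
  field
    unique  : Unique X
    ⊆vars   : X ⊆ vars φ
    reducts : (θ : Assignment 𝒪 X) → Consistent θ → 𝒞 (φ [ θ ]ʳ)

-- No clause of Φ is satisfied by every consistent assignment to all the
-- variables.  This is the usual convention that clauses are not
-- tautological, taking the consistency conditions into account:
-- ¬x ∨ x and ¬□*x ∨ □F x are both excluded.
TautologyFree : ∀ {𝒪} → CNF 𝒪 → Set
TautologyFree {𝒪} φ =
  All (λ c → Σ[ θ ∈ Assignment 𝒪 (vars φ) ] Consistent θ × satisfies θ c ≡ false) (Φ φ)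

------------------------------------------------------------------------
-- Model of computation: the WHILE language over binary trees (N. D. Jones,
-- Computability and Complexity from a Programming Perspective), with a
-- finite number of registers.  The basic operations are constant-time
-- pointer operations and create at most one new cell each, so that running
-- times agree with those of Turing machines up to a polynomial.

data Tree : Set where
  nil : Tree
  _∙_ : Tree → Tree → Tree

infixr 5 _∙_

size : Tree → ℕ
size nil     = 1
size (s ∙ t) = suc (size s + size t)

left right : Tree → Tree
left nil      = nil
left (s ∙ _)  = s
right nil     = nil
right (_ ∙ t) = t

data Expr (r : ℕ) : Set where
  reg   : Fin r → Expr r
  nil   : Expr r
  cons  : Expr r → Expr r → Expr r
  hd tl : Expr r → Expr r

data Cmd (r : ℕ) : Set where
  _:=_          : Fin r → Expr r → Cmd r
  _⨾_           : Cmd r → Cmd r → Cmd r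
  if_then_else_ : Expr r → Cmd r → Cmd r → Cmd r
  while_loop_   : Expr r → Cmd r → Cmd r

infix  6 _:=_
infixr 5 _⨾_

Store : ℕ → Set
Store r = Vec Tree r

eval : ∀ {r} → Store r → Expr r → Tree
eval σ (reg i)    = lookup σ i
eval σ nil        = nil
eval σ (cons e f) = eval σ e ∙ eval σ f
eval σ (hd e)     = left (eval σ e)
eval σ (tl e)     = right (eval σ e)

cost : ∀ {r} → Expr r → ℕ
cost (reg _)    = 1
cost nil        = 1
cost (cons e f) = suc (cost e + cost f)
cost (hd e)     = suc (cost e)
cost (tl e)     = suc (cost e)

-- ⟨ c , σ ⟩⇓ σ′ in-time t: started in store σ, the command c halts in
-- store σ′ after t steps.  In tests, nil is false.
data ⟨_,_⟩⇓_in-time_ {r : ℕ} : Cmd r → Store r → Store r → ℕ → Set where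
  assign : ∀ {σ i e} →
    ⟨ i := e , σ ⟩⇓ (σ [ i ]≔ eval σ e) in-time suc (cost e)
  seq : ∀ {σ σ₁ σ₂ c d s t} →
    ⟨ c , σ ⟩⇓ σ₁ in-time s → ⟨ d , σ₁ ⟩⇓ σ₂ in-time t →
    ⟨ c ⨾ d , σ ⟩⇓ σ₂ in-time (s + t)
  if-true : ∀ {σ σ₁ e c d t} → eval σ e ≢ nil →
    ⟨ c , σ ⟩⇓ σ₁ in-time t →
    ⟨ if e then c else d , σ ⟩⇓ σ₁ in-time (suc (cost e) + t)
  if-false : ∀ {σ σ₁ e c d t} → eval σ e ≡ nil →
    ⟨ d , σ ⟩⇓ σ₁ in-time t →
    ⟨ if e then c else d , σ ⟩⇓ σ₁ in-time (suc (cost e) + t)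
  while-true : ∀ {σ σ₁ σ₂ e c s t} → eval σ e ≢ nil →
    ⟨ c , σ ⟩⇓ σ₁ in-time s → ⟨ while e loop c , σ₁ ⟩⇓ σ₂ in-time t →
    ⟨ while e loop c , σ ⟩⇓ σ₂ in-time (suc (cost e) + (s + t))
  while-false : ∀ {σ e c} → eval σ e ≡ nil →
    ⟨ while e loop c , σ ⟩⇓ σ in-time suc (cost e)

-- Input and output are in register 0; the other registers start as nil.
record Program : Set where
  constructor program
  field
    extra : ℕ
    body  : Cmd (suc extra)

_on_↦_in-time_ : Program → Tree → Tree → ℕ → Set
program r c on x ↦ y in-time t =
  Σ[ σ ∈ Store (suc r) ] ⟨ c , x ∷ replicate r nil ⟩⇓ σ in-time t × head σ ≡ y

------------------------------------------------------------------------
-- Encodings as trees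

encBool : Bool → Tree
encBool false = nil
encBool true  = nil ∙ nil

encList : ∀ {A : Set} → (A → Tree) → List A → Tree
encList enc []       = nil
encList enc (x ∷ xs) = enc x ∙ encList enc xs

encMaybe : ∀ {A : Set} → (A → Tree) → Maybe A → Tree
encMaybe enc nothing  = nil
encMaybe enc (just x) = nil ∙ enc x

encℕᵇ : ℕᵇ → Tree
encℕᵇ 0ᵇ       = nil
encℕᵇ 2[1+ n ] = encBool false ∙ encℕᵇ n
encℕᵇ 1+[2 n ] = encBool true ∙ encℕᵇ n

encℕ : ℕ → Tree
encℕ n = encℕᵇ (fromℕ n)

encVar : Var → Tree
encVar = encList encBool

encOp : Op → Tree
encOp □F = nil ∙ nil
encOp □P = nil ∙ nil ∙ nil
encOp □* = (nil ∙ nil) ∙ nil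

module _ {𝒪 : OpSet} where

  encLiteral : Literal 𝒪 → Tree
  encLiteral ⊥ℓ                = nil
  encLiteral (at (var x))      = nil ∙ encVar x
  encLiteral (at (box o _ x))  = encOp o ∙ encVar x

  encClause : Clause 𝒪 → Tree
  encClause c = encList encLiteral (neg c) ∙ encList encLiteral (pos c)

  encCNF : CNF 𝒪 → Tree
  encCNF φ = encList encClause (Ψ φ) ∙ encList encClause (Φ φ)

------------------------------------------------------------------------
-- Fixed-parameter tractability

Computable : (ℕ → ℕ) → Set
Computable f = Σ[ P ∈ Program ] ∀ n → ∃[ t ] P on encℕ n ↦ encℕ (f n) in-time t

record ParamSearchProblem : Set₁ where
  field
    Instance  : Set
    encode    : Instance → Tree
    parameter : Instance → ℕ
    Solution  : Set
    encodeSol : Solution → Tree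
    _Solves_  : Solution → Instance → Set

  data Correct (i : Instance) : Maybe Solution → Set where
    found : ∀ {s} → s Solves i → Correct i (just s)
    none  : (∀ s → ¬ (s Solves i)) → Correct i nothing

FPT : ParamSearchProblem → Set
FPT Q =
  Σ[ f ∈ (ℕ → ℕ) ] Computable f ×
  (Σ[ P ∈ Program ] Σ[ c ∈ ℕ ]
    ∀ (i : Instance) → ∃[ answer ] Correct i answer ×
      (∃[ t ] P on encode i ↦ encMaybe encodeSol answer in-time t ×
              t ≤ f (parameter i) * size (encode i) ^ c))
  where open ParamSearchProblem Q

record DetectInstance (𝒪 : OpSet) : Set where
  field
    φ             : CNF 𝒪
    isLTLCNF      : IsLTLCNF φ
    -- With tautological clauses the problem would be W[2]-hard: the clause
    -- ⋁ₓ∈ₛ (¬x ∨ x) disappears as soon as one element of S is in the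
    -- backdoor, so it expresses that the backdoor hits S.
    tautologyFree : TautologyFree φ
    k             : ℕ

Detect : (𝒪 : OpSet) → (CNF 𝒪 → Set) → ParamSearchProblem
Detect 𝒪 𝒞 = record
  { Instance  = DetectInstance 𝒪
  ; encode    = λ i → encCNF (φ i) ∙ encℕ (k i)
  ; parameter = k
  ; Solution  = List Var
  ; encodeSol = encList encVar
  ; _Solves_  = λ X i → StrongBackdoor 𝒞 (φ i) X × length X ≤ k i
  }
  where open DetectInstance

{-# OPTIONS --safe #-}
module Submission where

-- Restricting a consistent assignment that falsifies a clause shows that, in
-- the absence of tautologies, X is a strong HORN-backdoor iff every clause has
-- at most one positive literal whose variable lies outside X.  Two uncovered
-- positive literals of one clause force one of their two variables into X, so
-- a bounded search tree with fewer than 2 ^ (k + 1) nodes decides the problem.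
-- The WHILE program keeps the unexplored nodes on a stack; a node costs
-- O(k · |φ|) steps, because every variable name occurring in φ is compared
-- with each of the at most k elements of X.

open import Data.Bool using (Bool; true; false; not; _∧_; _∨_) renaming (if_then_else_ to ifᵇ_then_else_)
open import Data.Bool.ListAction using (any)
open import Data.Bool.Properties using (∧-zeroʳ; ∧-identityʳ; ∨-identityʳ; ∨-zeroʳ; ∨-assoc; ∨-conicalˡ; ∨-conicalʳ)
open import Data.Empty using (⊥-elim)
open import Data.Fin using (zero; suc)
open import Data.List using (List; []; _∷_; filterᵇ; foldl; length)
open import Data.List.Membership.Propositional using (_∈_; find)
open import Data.List.Membership.Propositional.Properties using (∈-++⁺ʳ; ∈-concatMap⁺)
import Data.List.Membership.DecPropositional as DecMembership
open import Data.List.Properties using (length-filter)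
open import Data.List.Relation.Binary.Subset.Propositional using (_⊆_)
open import Data.List.Relation.Unary.All as All using (All; []; _∷_)
open import Data.List.Relation.Unary.All.Properties using (¬Any⇒All¬)
open import Data.List.Relation.Unary.AllPairs using ([]; _∷_)
open import Data.List.Relation.Unary.Any as Any using (Any; here; there)
open import Data.List.Relation.Unary.Unique.Propositional using (Unique)
open import Data.Maybe using (Maybe; just; nothing; maybe′; _<∣>_)
open import Data.Nat using (ℕ; zero; suc; _+_; _*_; _^_; _≤_; _<_; z≤n; s≤s)
open import Data.Nat.Binary using (ℕᵇ; 2[1+_]; 1+[2_]; fromℕ; toℕ) renaming (zero to 0ᵇ)
open import Data.Nat.Binary.Properties using (toℕ-fromℕ; fromℕ-toℕ)
open import Data.Nat.Properties
open import Data.Nat.Tactic.RingSolver using (solve-∀)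
open import Data.Product using (Σ-syntax; ∃-syntax; _×_; _,_; proj₁; proj₂)
open import Data.Sum using (_⊎_; inj₁; inj₂; [_,_]′)
open import Data.Vec using (Vec; []; _∷_; head; replicate; _[_]≔_)
open import Function using (_∘_)
open import Relation.Binary.PropositionalEquality
open import Relation.Nullary using (does; yes; no)
open import Relation.Nullary.Decidable using (dec-true)

open import Defs
open DecMembership _≟ᵛ_ using (_∈?_)

private variable
  A : Set
  𝒪 : OpSet
  r n s t : ℕ
  σ σ₁ σ₂ : Store r
  c d : Cmd r
  e : Expr r
  io : Tree
  ρ : Vec Tree n

-- Backdoors and covered literals

count : (A → Bool) → List A → ℕ
count p xs = length (filterᵇ p xs)

count-mono : ∀ {p q : A → Bool} {xs} → All (λ x → p x ≡ true → q x ≡ true) xs →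
  count p xs ≤ count q xs
count-mono [] = z≤n
count-mono {p = p} {q} {x ∷ xs} (p⇒q ∷ ps) with p x | q x | count-mono {p = p} {q} ps
... | false | false | ih = ih
... | false | true  | ih = m≤n⇒m≤1+n ih
... | true  | true  | ih = s≤s ih
... | true  | false | ih with () ← p⇒q refl

count-mono-< : ∀ {p q : A → Bool} {xs x} → (∀ y → p y ≡ true → q y ≡ true) →
  x ∈ xs → p x ≡ false → q x ≡ true → count p xs < count q xs
count-mono-< {p = p} {q} {x ∷ xs} p⇒q (here refl) px qx rewrite px | qx =
  s≤s (count-mono {p = p} {q} (All.universal p⇒q xs))
count-mono-< {p = p} {q} {y ∷ ys} p⇒q (there x∈) px qx
  with p y | q y | p⇒q y | count-mono-< {p = p} {q} p⇒q x∈ px qx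
... | false | false | _ | ih = ih
... | false | true  | _ | ih = m≤n⇒m≤1+n ih
... | true  | true  | _ | ih = s≤s ih
... | true  | false | h | _  with () ← h refl

count-positive : ∀ {p : A → Bool} {xs x} → x ∈ xs → p x ≡ true → 1 ≤ count p xs
count-positive (here refl) px rewrite px = s≤s z≤n
count-positive {p = p} {y ∷ _} (there x∈) px with p y
... | true  = s≤s z≤n
... | false = count-positive x∈ px

-- Two positions, not two values: a literal listed twice in a clause counts twice in the length that
-- `HORN` bounds, so `x` and `y` may coincide.
data Before {A : Set} (x y : A) : List A → Set where
  here  : ∀ {zs} → y ∈ zs → Before x y (x ∷ zs)
  there : ∀ {z zs} → Before x y zs → Before x y (z ∷ zs)

before-∈ : ∀ {x y : A} {zs} → Before x y zs → x ∈ zs × y ∈ zs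
before-∈ (here y∈) = here refl , there y∈
before-∈ (there b) with x∈ , y∈ ← before-∈ b = there x∈ , there y∈

before-count : ∀ {p : A → Bool} {x y zs} → Before x y zs → p x ≡ true → p y ≡ true → 2 ≤ count p zs
before-count (here y∈) px py rewrite px = s≤s (count-positive y∈ py)
before-count {p = p} {zs = z ∷ _} (there b) px py with p z
... | true  = m≤n⇒m≤1+n (before-count b px py)
... | false = before-count b px py

-- ⊥ is never removed by an assignment.
covers : List Var → Literal 𝒪 → Bool
covers X ⊥ℓ     = false
covers X (at a) = does (name a ∈? X)

AtMostOneUncovered : List (Clause 𝒪) → List Var → Set
AtMostOneUncovered cs X = All (λ c → count (not ∘ covers X) (pos c) ≤ 1) cs

module _ {X : List Var} {θ : Assignment 𝒪 X} where

  uncovered⇒¬false : ∀ l → not (covers X l) ≡ true → not (isFalse θ l) ≡ true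
  uncovered⇒¬false ⊥ℓ _ = refl
  uncovered⇒¬false (at a) h with name a ∈? X
  ... | yes _ with () ← h
  ... | no _  = refl

  ¬true⇒¬false⇒uncovered : ∀ l → isTrue θ l ≡ false → not (isFalse θ l) ≡ true → not (covers X l) ≡ true
  ¬true⇒¬false⇒uncovered ⊥ℓ _ _ = refl
  ¬true⇒¬false⇒uncovered (at a) t f with name a ∈? X
  ... | no _ = refl
  ... | yes x∈X with θ a x∈X
  ...   | false with () ← f

any-false : ∀ (p : A → Bool) xs → any p xs ≡ false → All (λ x → p x ≡ false) xs
any-false p [] _ = []
any-false p (x ∷ xs) eq with p x in px
... | false = px ∷ any-false p xs eq

any-mono : ∀ {p q : A → Bool} xs → (∀ x → q x ≡ false → p x ≡ false) → any q xs ≡ false → any p xs ≡ false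
any-mono [] h _ = refl
any-mono {p = p} {q} (x ∷ xs) h eq with q x in qx
... | false rewrite h x qx = any-mono xs h eq

-- A clause that survives has no true positive literal; its covered positive literals are therefore
-- false and deleted, and only uncovered ones remain.
covered⇒horn : ∀ {φ : CNF 𝒪} {X} → AtMostOneUncovered (Φ φ) X → (θ : Assignment 𝒪 X) → HORN (φ [ θ ]ʳ)
covered⇒horn {φ = φ} {X} h θ = go (Φ φ) h
  where
  go : ∀ cs → AtMostOneUncovered cs X → All (λ c → length (pos c) ≤ 1) (reduceClauses θ cs)
  go [] [] = []
  go (c ∷ cs) (p ∷ ps) with satisfies θ c in sat
  ... | true  = go cs ps
  ... | false = ≤-trans
    (count-mono (All.map (λ {l} → ¬true⇒¬false⇒uncovered l)
      (any-false (isTrue θ) (pos c) (∨-conicalʳ (any (isFalse θ) (neg c)) _ sat))))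
    p ∷ go cs ps

-- Since an assignment may depend on the membership proof, the restriction
-- always uses the proof found by _∈?_.
module Restrict {X V : List Var} (X⊆V : X ⊆ V) (θ : Assignment 𝒪 V) where

  restrict : Assignment 𝒪 X
  restrict a x∈X with name a ∈? V
  ... | yes x∈V = θ a x∈V
  ... | no  x∉V = ⊥-elim (x∉V (X⊆V x∈X))

  restrict-consistent : Consistent θ → Consistent restrict
  restrict-consistent con x x∈X h* eq with x ∈? V
  ... | yes x∈V = con x x∈V h* eq
  ... | no  x∉V = ⊥-elim (x∉V (X⊆V x∈X))

  restrict-isTrue : ∀ l → isTrue θ l ≡ false → isTrue restrict l ≡ false
  restrict-isTrue ⊥ℓ _ = refl
  restrict-isTrue (at a) eq with name a ∈? X
  ... | no _ = refl
  ... | yes x∈X with name a ∈? V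
  ...   | yes x∈V = eq
  ...   | no  x∉V = ⊥-elim (x∉V (X⊆V x∈X))

  restrict-isFalse : ∀ l → isFalse θ l ≡ false → isFalse restrict l ≡ false
  restrict-isFalse ⊥ℓ _ = refl
  restrict-isFalse (at a) eq with name a ∈? X
  ... | no _ = refl
  ... | yes x∈X with name a ∈? V
  ...   | yes x∈V = eq
  ...   | no  x∉V = ⊥-elim (x∉V (X⊆V x∈X))

  -- The restriction gives no value outside `X` and the value of `θ` inside, so it makes no literal
  -- true or false that `θ` did not.
  restrict-satisfies : ∀ c → satisfies θ c ≡ false → satisfies restrict c ≡ false
  restrict-satisfies c eq
    rewrite any-mono {p = isFalse restrict} (neg c) restrict-isFalse (∨-conicalˡ _ (any (isTrue θ) (pos c)) eq) =
    any-mono (pos c) restrict-isTrue (∨-conicalʳ (any (isFalse θ) (neg c)) _ eq)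

-- Each clause has its own assignment: restricted to `X`, the one that falsifies it keeps it in the
-- reduct, where all its uncovered positive literals survive and are counted by `HORN`.
horn⇒covered : ∀ {φ : CNF 𝒪} {X} → TautologyFree φ → StrongBackdoor HORN φ X → AtMostOneUncovered (Φ φ) X
horn⇒covered {φ = φ} {X} taut bd = go (Φ φ) taut reducts
  where
  open StrongBackdoor bd
  go : ∀ cs → All (λ c → Σ[ θ ∈ Assignment _ (vars φ) ] Consistent θ × satisfies θ c ≡ false) cs →
    ((θ : Assignment _ X) → Consistent θ → All (λ c → length (pos c) ≤ 1) (reduceClauses θ cs)) →
    AtMostOneUncovered cs X
  go [] [] _ = []
  go (c ∷ cs) ((θ , con , unsat) ∷ ts) hyp = first (hyp restrict (restrict-consistent con)) ∷ go cs ts rest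
    where
    open Restrict ⊆vars θ
    first : All (λ c → length (pos c) ≤ 1) (reduceClauses restrict (c ∷ cs)) → count (not ∘ covers X) (pos c) ≤ 1
    first all rewrite restrict-satisfies c unsat with q ∷ _ ← all =
      ≤-trans (count-mono (All.universal uncovered⇒¬false (pos c))) q
    rest : (θ : Assignment _ X) → Consistent θ → All (λ c → length (pos c) ≤ 1) (reduceClauses θ cs)
    rest θ con with satisfies θ c | hyp θ con
    ... | true  | all     = all
    ... | false | _ ∷ all = all

-- Finding a conflict

Conflict : OpSet → Set
Conflict 𝒪 = Literal 𝒪 × Literal 𝒪

-- The state (p , q) holds the first uncovered literal of the current clause
-- and the conflict found last.
scanLiteral : List Var → Maybe (Literal 𝒪) × Maybe (Conflict 𝒪) → Literal 𝒪 →
  Maybe (Literal 𝒪) × Maybe (Conflict 𝒪)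
scanLiteral X (p , q) l =
  ifᵇ covers X l then (p , q) else maybe′ (λ l′ → p , just (l′ , l)) (just l , q) p

scanClause : List Var → Maybe (Conflict 𝒪) → Clause 𝒪 → Maybe (Conflict 𝒪)
scanClause X q c = proj₂ (foldl (scanLiteral X) (nothing , q) (pos c))

scan : List Var → Maybe (Conflict 𝒪) → List (Clause 𝒪) → Maybe (Conflict 𝒪)
scan X = foldl (scanClause X)

ConflictIn : List Var → List (Literal 𝒪) → Conflict 𝒪 → Set
ConflictIn X ls (l₁ , l₂) = Before l₁ l₂ ls × covers X l₁ ≡ false × covers X l₂ ≡ false

module _ (X : List Var) where

  -- The stored literal is never replaced, so every conflict reported from here on starts with `l`;
  -- each uncovered literal of `ls` overwrites the conflict.
  scan-literals-just : ∀ l q (ls : List (Literal 𝒪)) → covers X l ≡ false →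
    (proj₂ (foldl (scanLiteral X) (just l , q) ls) ≡ q × count (not ∘ covers X) ls ≡ 0) ⊎
    (∃[ l′ ] proj₂ (foldl (scanLiteral X) (just l , q) ls) ≡ just (l , l′) × l′ ∈ ls × covers X l′ ≡ false)
  scan-literals-just l q [] u = inj₁ (refl , refl)
  scan-literals-just l q (m ∷ ls) u with covers X m in um
  ... | true  = [ inj₁ , (λ (l′ , eq , l′∈ , u′) → inj₂ (l′ , eq , there l′∈ , u′)) ]′
                (scan-literals-just l q ls u)
  ... | false = [ (λ (eq , _) → inj₂ (m , eq , here refl , um))
                , (λ (l′ , eq , l′∈ , u′) → inj₂ (l′ , eq , there l′∈ , u′)) ]′
                (scan-literals-just l (just (l , m)) ls u)

  scan-literals : ∀ q (ls : List (Literal 𝒪)) →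
    (proj₂ (foldl (scanLiteral X) (nothing , q) ls) ≡ q × count (not ∘ covers X) ls ≤ 1) ⊎
    (∃[ r ] proj₂ (foldl (scanLiteral X) (nothing , q) ls) ≡ just r × ConflictIn X ls r)
  scan-literals q [] = inj₁ (refl , z≤n)
  scan-literals q (m ∷ ls) with covers X m in um
  ... | true  = [ inj₁ , (λ (r , eq , b , u) → inj₂ (r , eq , there b , u)) ]′ (scan-literals q ls)
  ... | false = [ (λ (eq , c≡0) → inj₁ (eq , s≤s (≤-reflexive c≡0)))
                , (λ (l , eq , l∈ , ul) → inj₂ (_ , eq , here l∈ , um , ul)) ]′
                (scan-literals-just m q ls um)

  -- The last conflict wins, hence the case order: one found in the tail settles the matter, and
  -- otherwise the head clause decides.
  scan-spec : ∀ q (cs : List (Clause 𝒪)) →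
    (scan X q cs ≡ q × AtMostOneUncovered cs X) ⊎
    (∃[ r ] scan X q cs ≡ just r × Any (λ c → ConflictIn X (pos c) r) cs)
  scan-spec q [] = inj₁ (refl , [])
  scan-spec q (c ∷ cs) with scan-literals q (pos c) | scan-spec (scanClause X q c) cs
  ... | _                   | inj₂ (r , eq , r∈) = inj₂ (r , eq , there r∈)
  ... | inj₁ (eq₁ , one)    | inj₁ (eq₂ , ones)  = inj₁ (trans eq₂ eq₁ , one ∷ ones)
  ... | inj₂ (r , eq₁ , cr) | inj₁ (eq₂ , _)     = inj₂ (r , trans eq₂ eq₁ , here cr)

-- The bounded search tree

module Search (cs : List (Clause 𝒪)) where

  mutual
    -- `b` is the number of variables that may still be added; the recursion is structural in it.
    search : ℕ → List Var → Maybe (List Var)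
    search b X = maybe′ (split b X) (just X) (scan X nothing cs)

    split : ℕ → List Var → Conflict 𝒪 → Maybe (List Var)
    split zero    X _         = nothing
    split (suc b) X (l₁ , l₂) = extend b X l₁ <∣> extend b X l₂

    -- No variable covers ⊥, so a branch that asks for it fails at once.
    extend : ℕ → List Var → Literal 𝒪 → Maybe (List Var)
    extend b X ⊥ℓ     = nothing
    extend b X (at a) = search b (name a ∷ X)

  module Soundness (V : List Var) (cs⊆V : ∀ {c a} → c ∈ cs → at a ∈ pos c → name a ∈ V) where

    Sound : ℕ → List Var → Set
    Sound b Y = Unique Y × Y ⊆ V × AtMostOneUncovered cs Y × length Y ≤ b

    mutual
      search-sound : ∀ b X {Y} → Unique X → X ⊆ V → search b X ≡ just Y → Sound (b + length X) Y
      search-sound b X uX X⊆V eq with scan X nothing cs | scan-spec X nothing cs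
      search-sound b X uX X⊆V refl | nothing | inj₁ (_ , one) = uX , X⊆V , one , m≤n+m _ b
      ... | just r | inj₂ (_ , refl , any) with c , c∈ , cr ← find any = split-sound b X uX X⊆V c∈ r cr eq

      split-sound : ∀ b X {Y c} → Unique X → X ⊆ V → c ∈ cs → ∀ r → ConflictIn X (pos c) r →
        split b X r ≡ just Y → Sound (b + length X) Y
      split-sound (suc b) X uX X⊆V c∈ (l₁ , l₂) (bef , u₁ , u₂) eq with extend b X l₁ in e₁
      ... | just _  = extend-sound b X uX X⊆V c∈ l₁ (proj₁ (before-∈ bef)) u₁ (trans e₁ eq)
      ... | nothing = extend-sound b X uX X⊆V c∈ l₂ (proj₂ (before-∈ bef)) u₂ eq

      extend-sound : ∀ b X {Y c} → Unique X → X ⊆ V → c ∈ cs → ∀ l → l ∈ pos c → covers X l ≡ false →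
        extend b X l ≡ just Y → Sound (suc b + length X) Y
      extend-sound b X {Y} uX X⊆V c∈ (at a) l∈ u eq with name a ∈? X
      ... | no x∉X = subst (λ n → Sound n Y) (+-suc b (length X))
        (search-sound b (name a ∷ X) (¬Any⇒All¬ X x∉X ∷ uX)
          (λ { (here refl) → cs⊆V c∈ l∈ ; (there x∈) → X⊆V x∈ }) eq)

  module Completeness (Y : List Var) (cov : AtMostOneUncovered cs Y) where

    -- The induction measure. Every conflict contains a literal covered by `Y`, and branching on it
    -- lowers the measure, so a budget of at least `missing X` suffices.
    missing : List Var → ℕ
    missing X = count (λ y → not (does (y ∈? X))) Y

    extended : List Var → Literal 𝒪 → List Var
    extended X ⊥ℓ     = X
    extended X (at a) = name a ∷ X

    extend-missing : ∀ X l → covers Y l ≡ true → covers X l ≡ false → missing (extended X l) < missing X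
    extend-missing X (at a) v u with name a ∈? Y
    ... | yes x∈Y = count-mono-< shrinks x∈Y (cong not (dec-true (name a ∈? (name a ∷ X)) (here refl))) (cong not u)
      where
      shrinks : ∀ y → not (does (y ∈? (name a ∷ X))) ≡ true → not (does (y ∈? X)) ≡ true
      shrinks y eq with does (y ≟ᵛ name a)
      ... | false = eq

    mutual
      search-complete : ∀ b X → missing X ≤ b → search b X ≢ nothing
      search-complete b X m≤b eq with scan X nothing cs | scan-spec X nothing cs
      ... | just r | inj₂ (_ , refl , any) with c , c∈ , cr ← find any = split-complete b X m≤b c∈ r cr eq

      split-complete : ∀ b X {c} → missing X ≤ b → c ∈ cs → ∀ r → ConflictIn X (pos c) r → split b X r ≢ nothing
      split-complete b X m≤b c∈ (l₁ , l₂) (bef , u₁ , u₂) eq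
        with covers Y l₁ in v₁ | covers Y l₂ in v₂
      -- `Y` cannot miss both literals, since it leaves at most one positive literal of the clause
      -- uncovered.
      ... | false | false = <⇒≱ (before-count {p = not ∘ covers Y} bef (cong not v₁) (cong not v₂)) (All.lookup cov c∈)
      -- Without budget nothing of `Y` is missing, yet adding the covered literal would still lower
      -- that number.
      split-complete zero X m≤b c∈ (l₁ , l₂) (bef , u₁ , u₂) eq | true | _ with () ← ≤-trans (extend-missing X l₁ v₁ u₁) m≤b
      split-complete zero X m≤b c∈ (l₁ , l₂) (bef , u₁ , u₂) eq | _ | true with () ← ≤-trans (extend-missing X l₂ v₂ u₂) m≤b
      split-complete (suc b) X m≤b c∈ (l₁ , l₂) (bef , u₁ , u₂) eq | true | _ with extend b X l₁ in e₁
      ... | nothing = extend-complete b X m≤b l₁ v₁ u₁ e₁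
      split-complete (suc b) X m≤b c∈ (l₁ , l₂) (bef , u₁ , u₂) eq | _ | true with extend b X l₁ in e₁
      ... | nothing = extend-complete b X m≤b l₂ v₂ u₂ eq

      extend-complete : ∀ b X → missing X ≤ suc b → ∀ l → covers Y l ≡ true → covers X l ≡ false →
        extend b X l ≢ nothing
      extend-complete b X m≤b (at a) v u =
        search-complete b (name a ∷ X) (≤-pred (≤-trans (extend-missing X (at a) v u) m≤b))

-- Timed execution of WHILE programs

-- Naming the surplus turns the inequality into an equation, settled by evaluation or the ring
-- solver.
slack : ∀ {a b} s → a + s ≡ b → a ≤ b
slack {a} s refl = m≤m+n a s

record ⟨_,_⟩⇓_within_ (c : Cmd r) (σ σ₁ : Store r) (b : ℕ) : Set where
  constructor run
  field
    {time} : ℕ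
    exec   : ⟨ c , σ ⟩⇓ σ₁ in-time time
    bound  : time ≤ b

weaken : s ≤ t → ⟨ c , σ ⟩⇓ σ₁ within s → ⟨ c , σ ⟩⇓ σ₁ within t
weaken s≤t (run x p) = run x (≤-trans p s≤t)

assign! : ∀ {i} → ⟨ i := e , σ ⟩⇓ (σ [ i ]≔ eval σ e) within suc (cost e)
assign! = run assign ≤-refl

infixr 5 _then_

_then_ : ⟨ c , σ ⟩⇓ σ₁ within s → ⟨ d , σ₁ ⟩⇓ σ₂ within t → ⟨ c ⨾ d , σ ⟩⇓ σ₂ within (s + t)
run x p then run y q = run (seq x y) (+-mono-≤ p q)

if-true! : eval σ e ≢ nil → ⟨ c , σ ⟩⇓ σ₁ within t →
  ⟨ if e then c else d , σ ⟩⇓ σ₁ within (suc (cost e) + t)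
if-true! ne (run x p) = run (if-true ne x) (+-monoʳ-≤ _ p)

if-false! : eval σ e ≡ nil → ⟨ d , σ ⟩⇓ σ₁ within t →
  ⟨ if e then c else d , σ ⟩⇓ σ₁ within (suc (cost e) + t)
if-false! eq (run x p) = run (if-false eq x) (+-monoʳ-≤ _ p)

while-false! : eval σ e ≡ nil → ⟨ while e loop c , σ ⟩⇓ σ within suc (cost e)
while-false! eq = run (while-false eq) ≤-refl

while-true! : eval σ e ≢ nil → ⟨ c , σ ⟩⇓ σ₁ within s → ⟨ while e loop c , σ₁ ⟩⇓ σ₂ within t →
  ⟨ while e loop c , σ ⟩⇓ σ₂ within (suc (cost e) + (s + t))
while-true! {e = e} ne (run x p) (run y q) = run (while-true ne x y) (+-monoʳ-≤ (suc (cost e)) (+-mono-≤ p q))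

-- For inductions over a loop together with the code behind it: the run that remains is split at the
-- end of the loop and the round is put in front.
while-true-then! : eval σ e ≢ nil → ⟨ c , σ ⟩⇓ σ₁ within s → ⟨ while e loop c ⨾ d , σ₁ ⟩⇓ σ₂ within t →
  ⟨ while e loop c ⨾ d , σ ⟩⇓ σ₂ within (suc (cost e) + (s + t))
while-true-then! {e = e} ne (run {u} x p) (run (seq {s = v} {t = w} y z) q) = run (seq (while-true ne x y) z)
  (≤-trans (≤-reflexive (trans (+-assoc (suc (cost e)) (u + v) w) (cong (suc (cost e) +_) (+-assoc u v w))))
    (+-monoʳ-≤ (suc (cost e)) (+-mono-≤ p q)))

-- A command touches an initial segment of the registers and is polymorphic in
-- the remaining ones, so the tail ρ of a store frames what it leaves unchanged.
pattern %io    = zero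
pattern %a     = suc zero
pattern %b     = suc (suc zero)
pattern %e     = suc (suc (suc zero))
pattern %ys    = suc (suc (suc (suc zero)))
pattern %m     = suc (suc (suc (suc (suc zero))))
pattern %X     = suc (suc (suc (suc (suc (suc zero)))))
pattern %lits  = suc (suc (suc (suc (suc (suc (suc zero))))))
pattern %p     = suc (suc (suc (suc (suc (suc (suc (suc zero)))))))
pattern %q     = suc (suc (suc (suc (suc (suc (suc (suc (suc zero))))))))
pattern %cls   = suc (suc (suc (suc (suc (suc (suc (suc (suc (suc zero)))))))))
pattern %Φ     = suc (suc (suc (suc (suc (suc (suc (suc (suc (suc (suc zero))))))))))
pattern %k     = suc (suc (suc (suc (suc (suc (suc (suc (suc (suc (suc (suc zero)))))))))))
pattern %stack = suc (suc (suc (suc (suc (suc (suc (suc (suc (suc (suc (suc (suc zero))))))))))))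

skip : Cmd (suc n)
skip = %io := reg %io

trueᵉ : Expr n
trueᵉ = cons nil nil

size-positive : ∀ t → 1 ≤ size t
size-positive nil     = s≤s z≤n
size-positive (_ ∙ _) = s≤s z≤n

-- Comparing variable names and testing membership

equalLoop : Cmd (4 + n)
equalLoop =
  while reg %a loop (
    (if reg %b then skip else (%e := nil)) ⨾
    (if hd (reg %a) then (if hd (reg %b) then skip else (%e := nil))
                    else (if hd (reg %b) then %e := nil else skip)) ⨾
    %a := tl (reg %a) ⨾
    %b := tl (reg %b)) ⨾
  (if reg %b then %e := nil else skip) ⨾
  %b := nil

equal : Cmd (4 + n)
equal = %e := trueᵉ ⨾ equalLoop

-- Each round takes exactly 20 steps in every branch. Only the first word counts, so comparing a
-- name from the formula with a member of `X` costs time independent of the length of the latter.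
equalLoop-bound : Var → ℕ
equalLoop-bound []      = 20
equalLoop-bound (x ∷ u) = 20 + equalLoop-bound u

equalLoop-bound-size : ∀ u → equalLoop-bound u ≤ 20 * size (encVar u)
equalLoop-bound-size []      = ≤-refl
equalLoop-bound-size (x ∷ u) = begin
  20 + equalLoop-bound u      ≤⟨ +-monoʳ-≤ 20 (equalLoop-bound-size u) ⟩
  20 + 20 * size (encVar u)   ≡⟨ *-suc 20 _ ⟨
  20 * suc (size (encVar u))  ≤⟨ *-monoʳ-≤ 20 (s≤s (m≤n+m _ (size (encBool x)))) ⟩
  20 * size (encVar (x ∷ u))  ∎
  where open ≤-Reasoning

equalLoop-run : ∀ u v f →
  ⟨ equalLoop , io ∷ encVar u ∷ encVar v ∷ encBool f ∷ ρ ⟩⇓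
    (io ∷ nil ∷ nil ∷ encBool (f ∧ does (u ≟ᵛ v)) ∷ ρ) within (equalLoop-bound u)
equalLoop-run [] [] f rewrite ∧-identityʳ f =
  weaken (slack 12 refl) (while-false! refl then if-false! refl assign! then assign!)
equalLoop-run [] (y ∷ v) f rewrite ∧-zeroʳ f =
  weaken (slack 12 refl) (while-false! refl then if-true! (λ ()) assign! then assign!)
-- `hd` and `tl` of `nil` are `nil`, so an exhausted second word goes on behaving as the empty one,
-- with the flag cleared by the first test.
equalLoop-run (true ∷ u) [] f rewrite ∧-zeroʳ f = while-true-then! (λ ())
  (if-false! refl assign! then if-true! (λ ()) (if-false! refl assign!) then assign! then assign!)
  (equalLoop-run u [] false)
equalLoop-run (false ∷ u) [] f rewrite ∧-zeroʳ f = while-true-then! (λ ())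
  (if-false! refl assign! then if-false! refl (if-false! refl assign!) then assign! then assign!)
  (equalLoop-run u [] false)
equalLoop-run (true ∷ u) (true ∷ v) f = while-true-then! (λ ())
  (if-true! (λ ()) assign! then if-true! (λ ()) (if-true! (λ ()) assign!) then assign! then assign!)
  (equalLoop-run u v f)
equalLoop-run (true ∷ u) (false ∷ v) f rewrite ∧-zeroʳ f = while-true-then! (λ ())
  (if-true! (λ ()) assign! then if-true! (λ ()) (if-false! refl assign!) then assign! then assign!)
  (equalLoop-run u v false)
equalLoop-run (false ∷ u) (true ∷ v) f rewrite ∧-zeroʳ f = while-true-then! (λ ())
  (if-true! (λ ()) assign! then if-false! refl (if-true! (λ ()) assign!) then assign! then assign!)
  (equalLoop-run u v false)
equalLoop-run (false ∷ u) (false ∷ v) f = while-true-then! (λ ())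
  (if-true! (λ ()) assign! then if-false! refl (if-false! refl assign!) then assign! then assign!)
  (equalLoop-run u v f)

equal-run : ∀ u v {f} →
  ⟨ equal , io ∷ encVar u ∷ encVar v ∷ f ∷ ρ ⟩⇓
    (io ∷ nil ∷ nil ∷ encBool (does (u ≟ᵛ v)) ∷ ρ) within (4 + 20 * size (encVar u))
equal-run u v = assign! then weaken (equalLoop-bound-size u) (equalLoop-run u v true)

memberLoop : Cmd (8 + n)
memberLoop = while reg %ys loop (
  %a := tl (hd (reg %lits)) ⨾
  %b := hd (reg %ys) ⨾
  equal ⨾
  (if reg %e then (%m := trueᵉ) else skip) ⨾
  %e := nil ⨾
  %ys := tl (reg %ys))

flag-run : ∀ f g {a b ys} →
  ⟨ if reg %e then (%m := trueᵉ) else skip , io ∷ a ∷ b ∷ encBool g ∷ ys ∷ encBool f ∷ ρ ⟩⇓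
    (io ∷ a ∷ b ∷ encBool g ∷ ys ∷ encBool (f ∨ g) ∷ ρ) within 6
flag-run f true  rewrite ∨-zeroʳ f = if-true! (λ ()) assign!
flag-run f false rewrite ∨-identityʳ f = weaken (slack 2 refl) (if-false! refl assign!)

memberLoop-run : ∀ x X f {x′ o ls} →
  ⟨ memberLoop , io ∷ nil ∷ nil ∷ nil ∷ encList encVar X ∷ encBool f ∷ x′ ∷ ((o ∙ encVar x) ∙ ls) ∷ ρ ⟩⇓
    (io ∷ nil ∷ nil ∷ nil ∷ nil ∷ encBool (f ∨ does (x ∈? X)) ∷ x′ ∷ ((o ∙ encVar x) ∙ ls) ∷ ρ)
    within (2 + length X * (24 + 20 * size (encVar x)))
memberLoop-run x [] f rewrite ∨-identityʳ f = while-false! refl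
memberLoop-run x (y ∷ X) f rewrite sym (∨-assoc f (does (x ≟ᵛ y)) (does (x ∈? X))) =
  weaken (≤-reflexive (lemma (20 * size (encVar x)) (length X * (24 + 20 * size (encVar x)))))
    (while-true! (λ ())
      (assign! then assign! then equal-run x y then flag-run f (does (x ≟ᵛ y)) then assign! then assign!)
      (memberLoop-run x X (f ∨ does (x ≟ᵛ y))))
  where
  lemma : ∀ B M → 2 + ((4 + (3 + ((4 + B) + (6 + (2 + 3))))) + (2 + M)) ≡ 2 + (24 + B + M)
  lemma = solve-∀

-- The code of ⊥ is nil, and the member loop is then empty.
covered : Cmd (8 + n)
covered = (if hd (reg %lits) then (%ys := reg %X) else skip) ⨾ memberLoop

encAtom-name : ∀ (a : Atom 𝒪) → ∃[ o ] encLiteral (at a) ≡ o ∙ encVar (name a)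
encAtom-name (var x)     = nil , refl
encAtom-name (box o _ x) = encOp o , refl

-- 44 = 24 + 20 merges the fixed cost of a round with the rate of the comparison, as sizes are at
-- least 1; the `suc` on `length X` pays for the work outside the rounds.
covered-run : ∀ X (l : Literal 𝒪) {ls} →
  ⟨ covered , io ∷ nil ∷ nil ∷ nil ∷ nil ∷ nil ∷ encList encVar X ∷ (encLiteral l ∙ ls) ∷ ρ ⟩⇓
    (io ∷ nil ∷ nil ∷ nil ∷ nil ∷ encBool (covers X l) ∷ encList encVar X ∷ (encLiteral l ∙ ls) ∷ ρ)
    within (suc (length X) * (44 * size (encLiteral l)))
covered-run X ⊥ℓ = weaken (≤-trans (slack 37 refl) (m≤m+n 44 (length X * 44)))
  (if-false! refl assign! then while-false! refl)
covered-run X (at a) with encLiteral (at a) | encAtom-name a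
... | _ | o , refl = weaken (slack _ (lemma (length X) (size o) (size (encVar (name a)))))
  (if-true! (λ ()) assign! then memberLoop-run (name a) X false)
  where
  lemma : ∀ K o s → (3 + 2) + (2 + K * (24 + 20 * s)) + (37 + 44 * (o + s) + K * (20 + 44 * o + 24 * s)) ≡
    suc K * (44 * suc (o + s))
  lemma = solve-∀

-- Scanning the clauses

encConflict : Maybe (Conflict 𝒪) → Tree
encConflict nothing          = nil
encConflict (just (l₁ , l₂)) = encLiteral l₁ ∙ encLiteral l₂

-- `%p` stores a literal below a `cons`: ⊥ is coded by `nil` and would otherwise read as an empty
-- register.
literalStep : Cmd (10 + n)
literalStep =
  covered ⨾
  (if reg %m then skip else
    (if reg %p then (%q := cons (tl (reg %p)) (hd (reg %lits)))
               else (%p := cons nil (hd (reg %lits))))) ⨾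
  %m := nil ⨾
  %lits := tl (reg %lits)

literalLoop : Cmd (10 + n)
literalLoop = while reg %lits loop literalStep

literalStep-run : ∀ X p q (l : Literal 𝒪) {ls} →
  ⟨ literalStep , io ∷ nil ∷ nil ∷ nil ∷ nil ∷ nil ∷ encList encVar X ∷ (encLiteral l ∙ ls) ∷
      encMaybe encLiteral p ∷ encConflict q ∷ ρ ⟩⇓
    (io ∷ nil ∷ nil ∷ nil ∷ nil ∷ nil ∷ encList encVar X ∷ ls ∷
      encMaybe encLiteral (proj₁ (scanLiteral X (p , q) l)) ∷ encConflict (proj₂ (scanLiteral X (p , q) l)) ∷ ρ)
    within (suc (length X) * (44 * size (encLiteral l)) + 15)
literalStep-run X p q l with covers X l | (λ {io} {n} {ρ} {ls} → covered-run {io = io} {n} {ρ} X l {ls})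
... | true  | cov = weaken (+-monoʳ-≤ (suc (length X) * (44 * size (encLiteral l))) (slack 6 refl))
  (cov then if-true! (λ ()) assign! then assign! then assign!)
literalStep-run X (just l′) q l | false | cov =
  cov then if-false! refl (if-true! (λ ()) assign!) then assign! then assign!
literalStep-run X nothing q l | false | cov =
  weaken (+-monoʳ-≤ (suc (length X) * (44 * size (encLiteral l))) (slack 1 refl))
  (cov then if-false! refl (if-false! refl assign!) then assign! then assign!)

-- 61 = 44 + 15 + 2: the covering test, the rest of the step and the loop test.
literalLoop-run : ∀ X p q (ls : List (Literal 𝒪)) → let p′ , q′ = foldl (scanLiteral X) (p , q) ls in
  ⟨ literalLoop , io ∷ nil ∷ nil ∷ nil ∷ nil ∷ nil ∷ encList encVar X ∷ encList encLiteral ls ∷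
      encMaybe encLiteral p ∷ encConflict q ∷ ρ ⟩⇓
    (io ∷ nil ∷ nil ∷ nil ∷ nil ∷ nil ∷ encList encVar X ∷ nil ∷ encMaybe encLiteral p′ ∷ encConflict q′ ∷ ρ)
    within (suc (length X) * (61 * size (encList encLiteral ls)))
literalLoop-run X p q [] = weaken (≤-trans (slack 59 refl) (m≤m+n 61 (length X * 61))) (while-false! refl)
literalLoop-run X p q (l ∷ ls) =
  weaken (slack _ (lemma (length X) (size (encLiteral l)) (size (encList encLiteral ls))))
    (while-true! (λ ()) (literalStep-run X p q l) (literalLoop-run X _ _ ls))
  where
  lemma : ∀ K s t → 2 + ((suc K * (44 * s) + 15) + suc K * (61 * t)) + (44 + 17 * s + K * (61 + 17 * s)) ≡
    suc K * (61 * suc (s + t))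
  lemma = solve-∀

clauseLoop : Cmd (11 + n)
clauseLoop = while reg %cls loop (
  %lits := tl (hd (reg %cls)) ⨾
  literalLoop ⨾
  %p := nil ⨾
  %cls := tl (reg %cls))

-- The rate 61 carries over: the 11 further steps per clause are paid for by the two pairs that
-- enclose its literals.
clauseLoop-run : ∀ X q (cs : List (Clause 𝒪)) →
  ⟨ clauseLoop , io ∷ nil ∷ nil ∷ nil ∷ nil ∷ nil ∷ encList encVar X ∷ nil ∷ nil ∷ encConflict q ∷
      encList encClause cs ∷ ρ ⟩⇓
    (io ∷ nil ∷ nil ∷ nil ∷ nil ∷ nil ∷ encList encVar X ∷ nil ∷ nil ∷ encConflict (scan X q cs) ∷ nil ∷ ρ)
    within (suc (length X) * (61 * size (encList encClause cs)))
clauseLoop-run X q [] = weaken (≤-trans (slack 59 refl) (m≤m+n 61 (length X * 61))) (while-false! refl)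
clauseLoop-run X q (c ∷ cs) =
  weaken (slack _ (lemma (length X) (size (encList encLiteral (neg c))) (size (encList encLiteral (pos c)))
      (size (encList encClause cs))))
    (while-true! (λ ()) (assign! then literalLoop-run X nothing q (pos c) then assign! then assign!)
      (clauseLoop-run X _ cs))
  where
  lemma : ∀ K u s t → 2 + ((4 + (suc K * (61 * s) + (2 + 3))) + suc K * (61 * t)) +
      (111 + 61 * u + K * (122 + 61 * u)) ≡
    suc K * (61 * suc (suc (u + s) + t))
  lemma = solve-∀

-- Binary to unary conversion

-- ones n = 2 ^ n ∸ 1, whose encoding doubles as the unary numeral n.
ones : ℕ → ℕᵇ
ones zero    = 0ᵇ
ones (suc n) = 1+[2 ones n ]

unary : ℕ → Tree
unary n = encℕᵇ (ones n)

double : Cmd (5 + n)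
double = while reg %e loop (%ys := cons trueᵉ (cons trueᵉ (reg %ys)) ⨾ %e := tl (reg %e))

double-run : ∀ m k {a b} →
  ⟨ double , io ∷ a ∷ b ∷ unary m ∷ unary k ∷ ρ ⟩⇓ (io ∷ a ∷ b ∷ nil ∷ unary (m * 2 + k) ∷ ρ) within (2 + m * 15)
double-run zero k = while-false! refl
double-run {io} {_} {ρ} (suc m) k {a} {b} =
  subst₂ (λ j t → ⟨ double , io ∷ a ∷ b ∷ unary (suc m) ∷ unary k ∷ ρ ⟩⇓ (io ∷ a ∷ b ∷ nil ∷ unary j ∷ ρ) within t)
    (lemma₁ m k) (lemma₂ (m * 15)) (while-true! (λ ()) (assign! then assign!) (double-run m (2 + k)))
  where
  lemma₁ : ∀ m k → m * 2 + (2 + k) ≡ 2 + m * 2 + k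
  lemma₁ = solve-∀
  lemma₂ : ∀ M → 2 + (10 + 3 + (2 + M)) ≡ 2 + (15 + M)
  lemma₂ = solve-∀

-- Numerals begin with the least significant digit, whereas Horner's rule needs the most significant
-- one first.
reversed : ℕᵇ → Tree → Tree
reversed 0ᵇ       t = t
reversed 2[1+ n ] t = reversed n (encBool false ∙ t)
reversed 1+[2 n ] t = reversed n (encBool true ∙ t)

reverse : Cmd (3 + n)
reverse = while reg %a loop (%b := cons (hd (reg %a)) (reg %b) ⨾ %a := tl (reg %a))

reverse-step : ∀ d m → 2 + (5 + 3 + (2 + 10 * m)) + (10 * m + 10 * d) ≡ 2 + 10 * (suc d + 2 * m)
reverse-step = solve-∀

reverse-run : ∀ n {b} →
  ⟨ reverse , io ∷ encℕᵇ n ∷ b ∷ ρ ⟩⇓ (io ∷ nil ∷ reversed n b ∷ ρ) within (2 + 10 * toℕ n)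
reverse-run 0ᵇ = while-false! refl
reverse-run 2[1+ n ] = weaken
  (≤-trans (slack _ (reverse-step 1 (toℕ n))) (≤-reflexive (cong (λ m → 2 + 10 * m) (sym (*-suc 2 (toℕ n))))))
  (while-true! (λ ()) (assign! then assign!) (reverse-run n))
reverse-run 1+[2 n ] = weaken (slack _ (reverse-step 0 (toℕ n)))
  (while-true! (λ ()) (assign! then assign!) (reverse-run n))

-- σ₁ is reached after some rounds of the loop; the continuation form makes such
-- partial runs compose.
record ⟪_,_⟫_⟶_within_ (e : Expr r) (c : Cmd r) (σ σ₁ : Store r) (b : ℕ) : Set where
  constructor prefix
  field
    before : ∀ {σ₂ t} → ⟨ while e loop c , σ₁ ⟩⇓ σ₂ within t → ⟨ while e loop c , σ ⟩⇓ σ₂ within (b + t)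

open ⟪_,_⟫_⟶_within_

⟶-refl : ⟪ e , c ⟫ σ ⟶ σ within t
⟶-refl {t = t} = prefix (weaken (m≤n+m _ t))

⟶-step : eval σ e ≢ nil → ⟨ c , σ ⟩⇓ σ₁ within s → suc (cost e) + s ≤ t → ⟪ e , c ⟫ σ ⟶ σ₁ within t
⟶-step {e = e} {s = s} ne x le = prefix λ {_} {t} y →
  weaken (≤-trans (≤-reflexive (sym (+-assoc (suc (cost e)) s t))) (+-monoˡ-≤ t le)) (while-true! ne x y)

⟶-trans : ⟪ e , c ⟫ σ ⟶ σ₁ within s → ⟪ e , c ⟫ σ₁ ⟶ σ₂ within t → ⟪ e , c ⟫ σ ⟶ σ₂ within (s + t)
⟶-trans {s = s} {t = t} f g = prefix λ {_} {u} x → weaken (≤-reflexive (sym (+-assoc s t u))) (before f (before g x))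

⟶-weaken : s ≤ t → ⟪ e , c ⟫ σ ⟶ σ₁ within s → ⟪ e , c ⟫ σ ⟶ σ₁ within t
⟶-weaken s≤t f = prefix λ {_} {u} x → weaken (+-monoˡ-≤ u s≤t) (before f x)

-- `ℕᵇ` is bijective binary: the digit `true` stands for 1 and `false` for 2, hence the value from
-- which `double` starts.
hornerStep : Cmd (5 + n)
hornerStep =
  (if hd (reg %b) then (%ys := cons trueᵉ nil) else (%ys := cons trueᵉ (cons trueᵉ nil))) ⨾
  double ⨾
  %e := reg %ys ⨾
  %ys := nil ⨾
  %b := tl (reg %b)

hornerStep-run : ∀ d k {a b} → let j = k * 2 + (ifᵇ d then 1 else 2) in
  ⟨ hornerStep , io ∷ a ∷ (encBool d ∙ b) ∷ unary k ∷ nil ∷ ρ ⟩⇓ (io ∷ a ∷ b ∷ unary j ∷ nil ∷ ρ) within (22 + k * 15)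
hornerStep-run false k = weaken (≤-reflexive (lemma (k * 15)))
  (if-false! refl assign! then double-run k 2 then assign! then assign! then assign!)
  where
  lemma : ∀ M → (3 + 10) + ((2 + M) + (2 + (2 + 3))) ≡ 22 + M
  lemma = solve-∀
hornerStep-run true k = weaken (slack 4 (lemma (k * 15)))
  (if-true! (λ ()) assign! then double-run k 1 then assign! then assign! then assign!)
  where
  lemma : ∀ M → (3 + 6) + ((2 + M) + (2 + (2 + 3))) + 4 ≡ 22 + M
  lemma = solve-∀

-- The outermost digit of `n` is read last, so the induction hypothesis describes the run up to the
-- point where only that digit and `b` are left. The costs of the rounds grow geometrically, which
-- keeps the total linear in `toℕ n`.
horner-run : ∀ n {a b} →
  ⟪ reg %b , hornerStep ⟫ (io ∷ a ∷ reversed n b ∷ nil ∷ nil ∷ ρ) ⟶ (io ∷ a ∷ b ∷ unary (toℕ n) ∷ nil ∷ ρ)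
    within (24 * toℕ n)
horner-run 0ᵇ = ⟶-refl
horner-run {io} {_} {ρ} 2[1+ n ] {a} {b} = subst
  (λ j → ⟪ reg %b , hornerStep ⟫ (io ∷ a ∷ reversed 2[1+ n ] b ∷ nil ∷ nil ∷ ρ) ⟶
    (io ∷ a ∷ b ∷ unary j ∷ nil ∷ ρ) within (24 * (2 * suc (toℕ n))))
  (lemma₁ (toℕ n))
  (⟶-weaken (slack _ (lemma₂ (toℕ n))) (⟶-trans (horner-run n) (⟶-step (λ ()) (hornerStep-run false (toℕ n)) ≤-refl)))
  where
  lemma₁ : ∀ m → m * 2 + 2 ≡ 2 * suc m
  lemma₁ = solve-∀
  lemma₂ : ∀ m → 24 * m + (2 + (22 + m * 15)) + (24 + 9 * m) ≡ 24 * (2 * suc m)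
  lemma₂ = solve-∀
horner-run {io} {_} {ρ} 1+[2 n ] {a} {b} = subst
  (λ j → ⟪ reg %b , hornerStep ⟫ (io ∷ a ∷ reversed 1+[2 n ] b ∷ nil ∷ nil ∷ ρ) ⟶
    (io ∷ a ∷ b ∷ unary j ∷ nil ∷ ρ) within (24 * suc (2 * toℕ n)))
  (lemma₁ (toℕ n))
  (⟶-weaken (slack _ (lemma₂ (toℕ n))) (⟶-trans (horner-run n) (⟶-step (λ ()) (hornerStep-run true (toℕ n)) ≤-refl)))
  where
  lemma₁ : ∀ m → m * 2 + 1 ≡ suc (2 * m)
  lemma₁ = solve-∀
  lemma₂ : ∀ m → 24 * m + (2 + (22 + m * 15)) + (9 * m) ≡ 24 * suc (2 * m)
  lemma₂ = solve-∀

-- A unary budget is tested for zero directly and decremented by `tl`.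
toUnary : Cmd (5 + n)
toUnary = reverse ⨾ while reg %b loop hornerStep

toUnary-run : ∀ k →
  ⟨ toUnary , io ∷ encℕ k ∷ nil ∷ nil ∷ nil ∷ ρ ⟩⇓ (io ∷ nil ∷ nil ∷ unary k ∷ nil ∷ ρ) within (4 + 34 * k)
toUnary-run {io} {_} {ρ} k = subst
  (λ j → ⟨ toUnary , io ∷ encℕ k ∷ nil ∷ nil ∷ nil ∷ ρ ⟩⇓ (io ∷ nil ∷ nil ∷ unary j ∷ nil ∷ ρ) within (4 + 34 * j))
  (toℕ-fromℕ k)
  (weaken (≤-reflexive (lemma (toℕ (fromℕ k)))) (reverse-run (fromℕ k) then before (horner-run (fromℕ k)) (while-false! refl)))
  where
  lemma : ∀ m → 2 + 10 * m + (24 * m + 2) ≡ 4 + 34 * m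
  lemma = solve-∀

visits : ℕ → ℕ
visits k = toℕ (ones (suc k))

-- (k + 1)(2 ^ (k + 1) ∸ 1) ≤ 2 ^ (2k + 1) ∸ 1 covers the number of nodes and the
-- factor k + 1 in the cost of one node.
timeFactor : ℕ → ℕ
timeFactor k = toℕ (ones (k * 2 + 1))

-- Doubling `k` onto 1 leaves the unary 2k + 1, which read in binary is already the output.
timeFactorProgram : Cmd 5
timeFactorProgram = %a := reg %io ⨾ toUnary ⨾ %ys := cons trueᵉ nil ⨾ double ⨾ %io := reg %ys

timeFactorProgram-run : ∀ k → ∃[ t ]
  ⟨ timeFactorProgram , encℕ k ∷ nil ∷ nil ∷ nil ∷ nil ∷ [] ⟩⇓
    (unary (k * 2 + 1) ∷ nil ∷ nil ∷ nil ∷ unary (k * 2 + 1) ∷ []) within t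
timeFactorProgram-run k = _ , (assign! then toUnary-run k then assign! then double-run k 1 then assign!)

timeFactor-computable : Computable timeFactor
timeFactor-computable = program 4 timeFactorProgram ,
  λ k → _ , _ , ⟨_,_⟩⇓_within_.exec (proj₂ (timeFactorProgram-run k)) , cong encℕᵇ (sym (fromℕ-toℕ (ones (k * 2 + 1))))

-- The search loop

pushExpr : Expr 14 → Expr 14
pushExpr e = cons (cons (cons (tl e) (reg %X)) (tl (reg %k))) (reg %stack)

-- A test on the code of the literal suffices: ⊥, coded by `nil`, opens no branch, just as in
-- `extend`.
push : Expr 14 → Cmd 14
push e = if e then (%stack := pushExpr e) else skip

-- The second literal is pushed first, so that the first is explored first, as in `split`; success
-- empties the stack and thereby ends the loop.
visit : Cmd 14
visit =
  %X := hd (hd (reg %stack)) ⨾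
  %k := tl (hd (reg %stack)) ⨾
  %stack := tl (reg %stack) ⨾
  %cls := reg %Φ ⨾
  clauseLoop ⨾
  (if reg %q
    then (if reg %k then (push (tl (reg %q)) ⨾ push (hd (reg %q))) else skip)
    else (%io := cons nil (reg %X) ⨾ %stack := nil)) ⨾
  %X := nil ⨾
  %k := nil ⨾
  %q := nil

encState : ℕ → List Var → Tree
encState b X = encList encVar X ∙ unary b

module _ (cs : List (Clause 𝒪)) where
  open Search cs

  idle : Tree → Tree → Store 14
  idle io stack = io ∷ nil ∷ nil ∷ nil ∷ nil ∷ nil ∷ nil ∷ nil ∷ nil ∷ nil ∷ nil ∷ encList encClause cs ∷ nil ∷ stack ∷ []

  after : Maybe (List Var) → Tree → Store 14
  after nothing  rest = idle nil rest
  after (just X) rest = idle (nil ∙ encList encVar X) nil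

  pushed : ℕ → List Var → Literal 𝒪 → Tree → Tree
  pushed b X ⊥ℓ     rest = rest
  pushed b X (at a) rest = encState b (name a ∷ X) ∙ rest

  push-run : ∀ b X l e {a₀ a₁ a₂ a₃ a₄ a₅ a₆ a₇ a₈ a₉ a₁₀ rest} →
    let σ⟨_⟩ = λ stack → a₀ ∷ a₁ ∷ a₂ ∷ a₃ ∷ a₄ ∷ a₅ ∷ encList encVar X ∷ a₆ ∷ a₇ ∷ a₈ ∷ a₉ ∷ a₁₀ ∷ unary (suc b) ∷ stack ∷ [] in
    eval σ⟨ rest ⟩ e ≡ encLiteral l →
    ⟨ push e , σ⟨ rest ⟩ ⟩⇓ σ⟨ pushed b X l rest ⟩ within (suc (cost e) + suc (cost (pushExpr e)))
  push-run b X ⊥ℓ e eq = weaken (+-monoʳ-≤ (suc (cost e)) (s≤s (s≤s z≤n))) (if-false! eq assign!)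
  push-run b X (at a) e {a₀} {a₁} {a₂} {a₃} {a₄} {a₅} {a₆} {a₇} {a₈} {a₉} {a₁₀} {rest} eq
    with encLiteral (at a) | encAtom-name a
  ... | _ | o , refl = subst
    (λ x → ⟨ push e , _ ⟩⇓ (a₀ ∷ a₁ ∷ a₂ ∷ a₃ ∷ a₄ ∷ a₅ ∷ encList encVar X ∷ a₆ ∷ a₇ ∷ a₈ ∷ a₉ ∷ a₁₀ ∷ unary (suc b) ∷
        (((x ∙ encList encVar X) ∙ unary b) ∙ rest) ∷ []) within (suc (cost e) + suc (cost (pushExpr e))))
    (cong right eq)
    (if-true! (λ e≡nil → nonempty (trans (sym eq) e≡nil)) assign!)
    where
    nonempty : ∀ {s t} → s ∙ t ≢ nil
    nonempty ()

  expanded : ℕ → List Var → Maybe (Conflict 𝒪) → Tree → Store 14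
  expanded b       X nothing          rest = idle (nil ∙ encList encVar X) nil
  expanded zero    X (just _)         rest = idle nil rest
  expanded (suc b) X (just (l₁ , l₂)) rest = idle nil (pushed b X l₁ (pushed b X l₂ rest))

  scanTime : List Var → ℕ
  scanTime X = suc (length X) * (61 * size (encList encClause cs))

  visit-run : ∀ b X rest →
    ⟨ visit , idle nil (encState b X ∙ rest) ⟩⇓ expanded b X (scan X nothing cs) rest within (scanTime X + 51)
  visit-run b X rest = weaken (≤-reflexive (lemma (scanTime X)))
    (assign! then assign! then assign! then assign! then clauseLoop-run X nothing cs then
     expand b (scan X nothing cs))
    where
    lemma : ∀ c → 4 + (4 + (3 + (2 + (c + 38)))) ≡ c + 51
    lemma = solve-∀
    expand : ∀ b q →
      ⟨ (if reg %q
          then (if reg %k then (push (tl (reg %q)) ⨾ push (hd (reg %q))) else skip)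
          else (%io := cons nil (reg %X) ⨾ %stack := nil)) ⨾
        %X := nil ⨾ %k := nil ⨾ %q := nil ,
        nil ∷ nil ∷ nil ∷ nil ∷ nil ∷ nil ∷ encList encVar X ∷ nil ∷ nil ∷ encConflict q ∷ nil ∷
          encList encClause cs ∷ unary b ∷ rest ∷ [] ⟩⇓
      expanded b X q rest within 38
    expand b       nothing          = weaken (slack _ refl)
      (if-false! refl (assign! then assign!) then assign! then assign! then assign!)
    expand zero    (just _)         = weaken (slack _ refl)
      (if-true! (λ ()) (if-false! refl assign!) then assign! then assign! then assign!)
    expand (suc b) (just (l₁ , l₂)) = weaken (slack _ refl)
      (if-true! (λ ()) (if-true! (λ ())
        (push-run b X l₂ (tl (reg %q)) refl then push-run b X l₁ (hd (reg %q)) refl)) then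
       assign! then assign! then assign!)

  module _ (k T : ℕ) (visit-bound : ∀ X → length X ≤ k → 2 + (scanTime X + 51) ≤ T) where

    Explores : Store 14 → Store 14 → ℕ → Set
    Explores σ σ₁ b = ⟪ reg %stack , visit ⟫ σ ⟶ σ₁ within (visits b * T)

    visit-step : ∀ b X rest → length X + b ≤ k →
      ⟪ reg %stack , visit ⟫ idle nil (encState b X ∙ rest) ⟶ expanded b X (scan X nothing cs) rest within T
    visit-step b X rest X≤k = ⟶-step (λ ()) (visit-run b X rest) (visit-bound X (≤-trans (m≤m+n _ b) X≤k))

    -- After a success the stack is empty and the second branch never runs; its time is mere
    -- surplus.
    choose-run : ∀ m₁ m₂ {σ rest₁ rest s t} →
      ⟪ reg %stack , visit ⟫ σ ⟶ after m₁ rest₁ within s →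
      ⟪ reg %stack , visit ⟫ idle nil rest₁ ⟶ after m₂ rest within t →
      ⟪ reg %stack , visit ⟫ σ ⟶ after (m₁ <∣> m₂) rest within (s + t)
    choose-run (just _) _ {s = s} {t} run₁ _    = ⟶-weaken (m≤m+n s t) run₁
    choose-run nothing  _             run₁ run₂ = ⟶-trans run₁ run₂

    mutual
      -- The invariant keeps every explored list within `k` elements, so that each visit takes at
      -- most `T` steps, loop test included.
      search-run : ∀ b X rest → length X + b ≤ k →
        Explores (idle nil (encState b X ∙ rest)) (after (search b X) rest) b
      search-run b X rest X≤k = expanded-run b X rest X≤k (scan X nothing cs) (visit-step b X rest X≤k)

      expanded-run : ∀ b X rest → length X + b ≤ k → ∀ q {σ} →
        ⟪ reg %stack , visit ⟫ σ ⟶ expanded b X q rest within T →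
        Explores σ (after (maybe′ (split b X) (just X) q) rest) b
      expanded-run b       X rest X≤k nothing          v = ⟶-weaken (m≤m+n T _) v
      expanded-run zero    X rest X≤k (just _)         v = ⟶-weaken (m≤m+n T _) v
      expanded-run (suc b) X rest X≤k (just (l₁ , l₂)) v = ⟶-weaken (≤-reflexive (lemma (visits b) T))
        (⟶-trans v (choose-run (extend b X l₁) (extend b X l₂)
          (extend-run b X l₁ (pushed b X l₂ rest) X≤k) (extend-run b X l₂ rest X≤k)))
        where
        lemma : ∀ v t → t + (v * t + v * t) ≡ suc (2 * v) * t
        lemma = solve-∀

      extend-run : ∀ b X l rest → length X + suc b ≤ k →
        Explores (idle nil (pushed b X l rest)) (after (extend b X l) rest) b
      extend-run b X ⊥ℓ     rest X≤k = ⟶-refl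
      extend-run b X (at a) rest X≤k = search-run b (name a ∷ X) rest (subst (_≤ k) (+-suc (length X) b) X≤k)

-- The time bound and the correctness of the program

ones-scale : ∀ j n → 2 ^ j * toℕ (ones n) ≤ toℕ (ones (j + n))
ones-scale zero n = ≤-reflexive (+-identityʳ _)
ones-scale (suc j) n = begin
  2 * 2 ^ j * toℕ (ones n)      ≡⟨ *-assoc 2 (2 ^ j) _ ⟩
  2 * (2 ^ j * toℕ (ones n))    ≤⟨ *-monoʳ-≤ 2 (ones-scale j n) ⟩
  2 * toℕ (ones (j + n))        ≤⟨ n≤1+n _ ⟩
  toℕ (ones (suc j + n))        ∎
  where open ≤-Reasoning

visits-timeFactor : ∀ k → visits k * suc k ≤ timeFactor k
visits-timeFactor k = begin
  visits k * suc k            ≡⟨ *-comm (visits k) (suc k) ⟩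
  suc k * visits k            ≤⟨ *-monoˡ-≤ (visits k) (n<2ⁿ k) ⟩
  2 ^ k * visits k            ≤⟨ ones-scale k (suc k) ⟩
  toℕ (ones (k + suc k))      ≡⟨ cong (toℕ ∘ ones) (lemma k) ⟩
  timeFactor k                ∎
  where
  open ≤-Reasoning
  lemma : ∀ k → k + suc k ≡ k * 2 + 1
  lemma = solve-∀
  n<2ⁿ : ∀ n → suc n ≤ 2 ^ n
  n<2ⁿ zero    = ≤-refl
  n<2ⁿ (suc n) = begin
    suc (suc n)          ≤⟨ s≤s (m≤n+m (suc n) n) ⟩
    suc n + suc n        ≡⟨ cong (suc n +_) (+-identityʳ (suc n)) ⟨
    2 * suc n            ≤⟨ *-monoʳ-≤ 2 (n<2ⁿ n) ⟩
    2 ^ suc n            ∎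

detect : Cmd 14
detect =
  %Φ := tl (hd (reg %io)) ⨾
  %a := tl (reg %io) ⨾
  %io := nil ⨾
  toUnary ⨾
  %stack := cons (cons nil (reg %e)) nil ⨾
  %e := nil ⨾
  while reg %stack loop visit

-- 53 = 2 + 51 is the fixed cost of a visit, and 114 = 61 + 53.
visitTime-bound : ∀ {l k M} → l ≤ k → 1 ≤ M → 2 + (suc l * (61 * M) + 51) ≤ suc k * (114 * M)
visitTime-bound {l} {k} {M} l≤k 1≤M = begin
  2 + (suc l * (61 * M) + 51)          ≡⟨ lemma₁ (suc l * (61 * M)) ⟩
  suc l * (61 * M) + 1 * (53 * 1)      ≤⟨ +-mono-≤ (*-monoˡ-≤ (61 * M) (s≤s l≤k))
                                            (*-mono-≤ (s≤s (z≤n {k})) (*-monoʳ-≤ 53 1≤M)) ⟩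
  suc k * (61 * M) + suc k * (53 * M)  ≡⟨ lemma₂ (suc k) M ⟩
  suc k * (114 * M)                    ∎
  where
  open ≤-Reasoning
  lemma₁ : ∀ x → 2 + (x + 51) ≡ x + 1 * (53 * 1)
  lemma₁ = solve-∀
  lemma₂ : ∀ k m → k * (61 * m) + k * (53 * m) ≡ k * (114 * m)
  lemma₂ = solve-∀

-- 148 = 114 + 34 joins the search with the remaining steps, as 23 + 34k is at most 34(k + 1). Since
-- 5 ^ 4 = 625, the factor `N ^ 4` absorbs 148, and one more `N` bounds `M`.
detectTime-bound : ∀ k {M N} → 1 ≤ M → M ≤ N → 5 ≤ N →
  4 + (3 + (2 + ((4 + 34 * k) + (6 + (2 + (visits k * (suc k * (114 * M)) + 2)))))) ≤ timeFactor k * N ^ 5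
detectTime-bound k {M} {N} 1≤M M≤N 5≤N = begin
  4 + (3 + (2 + ((4 + 34 * k) + (6 + (2 + (V * (suc k * (114 * M)) + 2))))))
    ≡⟨ lemma₁ k (V * (suc k * (114 * M))) ⟩
  (23 + 34 * k) + V * (suc k * (114 * M))
    ≤⟨ +-monoˡ-≤ _ (slack 11 (lemma₂ k)) ⟩
  1 * (suc k * (34 * 1)) + V * (suc k * (114 * M))
    ≤⟨ +-monoˡ-≤ _ (*-mono-≤ {1} {V} (s≤s z≤n) (*-monoʳ-≤ (suc k) (*-monoʳ-≤ 34 1≤M))) ⟩
  V * (suc k * (34 * M)) + V * (suc k * (114 * M))
    ≡⟨ lemma₃ V (suc k) M ⟩
  V * suc k * (148 * M)
    ≤⟨ *-mono-≤ (visits-timeFactor k) (*-mono-≤ {148} {N ^ 4} (≤-trans (slack 477 refl) (^-monoˡ-≤ 4 5≤N)) M≤N) ⟩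
  timeFactor k * (N ^ 4 * N)
    ≡⟨ cong (timeFactor k *_) (*-comm (N ^ 4) N) ⟩
  timeFactor k * N ^ 5 ∎
  where
  open ≤-Reasoning
  V = visits k
  lemma₁ : ∀ k x → 4 + (3 + (2 + ((4 + 34 * k) + (6 + (2 + (x + 2)))))) ≡ (23 + 34 * k) + x
  lemma₁ = solve-∀
  lemma₂ : ∀ k → 23 + 34 * k + 11 ≡ 1 * (suc k * (34 * 1))
  lemma₂ = solve-∀
  lemma₃ : ∀ v k m → v * (k * (34 * m)) + v * (k * (114 * m)) ≡ v * k * (148 * m)
  lemma₃ = solve-∀

module _ (φ : CNF 𝒪) (k : ℕ) where
  open Search (Φ φ)

  detect-run : ∀ T → (∀ X → length X ≤ k → 2 + (scanTime (Φ φ) X + 51) ≤ T) →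
    ⟨ detect , (encCNF φ ∙ encℕ k) ∷ replicate 13 nil ⟩⇓ after (Φ φ) (search k []) nil within
    (4 + (3 + (2 + ((4 + 34 * k) + (6 + (2 + (visits k * T + 2)))))))
  detect-run T visit-bound =
    assign! then assign! then assign! then toUnary-run k then assign! then assign! then
    before (search-run (Φ φ) k T visit-bound k [] nil ≤-refl) (stop (search k []))
    where
    stop : ∀ m → ⟨ while reg %stack loop visit , after (Φ φ) m nil ⟩⇓ after (Φ φ) m nil within 2
    stop nothing  = while-false! refl
    stop (just _) = while-false! refl

  output : ∀ m → head (after (Φ φ) m nil) ≡ encMaybe (encList encVar) m
  output nothing  = refl
  output (just _) = refl

  positive-vars : ∀ {c a} → c ∈ Φ φ → at a ∈ pos c → name a ∈ vars φ
  positive-vars {c} c∈ a∈ = ∈-concatMap⁺ clauseVars (Any.map (λ { refl →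
      ∈-concatMap⁺ litVars (Any.map (λ { refl → here refl }) (∈-++⁺ʳ (neg c) a∈)) })
    (∈-++⁺ʳ (Ψ φ) c∈))

module _ (i : DetectInstance 𝒪) where
  open DetectInstance i
  open Search (Φ φ)
  open Soundness (vars φ) (positive-vars φ k)

  search-correct : ∀ m → search k [] ≡ m → ParamSearchProblem.Correct (Detect 𝒪 HORN) i m
  search-correct (just X) eq with uX , X⊆V , one , len ← search-sound k [] [] (λ ()) eq =
    ParamSearchProblem.found (record { unique = uX ; ⊆vars = X⊆V ; reducts = λ θ _ → covered⇒horn {φ = φ} one θ } ,
      subst (length X ≤_) (+-identityʳ k) len)
  search-correct nothing eq = ParamSearchProblem.none λ Y (backdoor , Y≤k) →
    let open Completeness Y (horn⇒covered {φ = φ} tautologyFree backdoor)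
    -- Initially nothing has been chosen, so the measure is at most `length Y`.
    in search-complete k [] (≤-trans (length-filter _ Y) Y≤k) eq

encClauses-size : ∀ (φ : CNF 𝒪) t → size (encList encClause (Φ φ)) ≤ size (encCNF φ ∙ t)
encClauses-size φ t = ≤-trans (m≤n+m _ (suc (suc (size (encList encClause (Ψ φ)))))) (m≤m+n _ (size t))

input-size : ∀ (φ : CNF 𝒪) t → 5 ≤ size (encCNF φ ∙ t)
input-size φ t = s≤s (+-mono-≤ (s≤s (+-mono-≤ (size-positive (encList encClause (Ψ φ)))
  (size-positive (encList encClause (Φ φ))))) (size-positive t))

theorem5 : (𝒪 : OpSet) → FPT (Detect 𝒪 HORN)
theorem5 𝒪 = timeFactor , timeFactor-computable , program 13 detect , 5 , λ i →
  let open DetectInstance i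
      M   = size (encList encClause (Φ φ))
      1≤M = size-positive (encList encClause (Φ φ))
      run exec bound = detect-run φ k (suc k * (114 * M)) (λ X X≤k → visitTime-bound X≤k 1≤M)
  in Search.search (Φ φ) k [] , search-correct i _ refl ,
     _ , (_ , exec , output φ k _) ,
     ≤-trans bound (detectTime-bound k 1≤M (encClauses-size φ (encℕ k)) (input-size φ (encℕ k)))
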